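{- Let $\langle E_1,\ldots,E_n,op_1,\ldots,op_p\rangle$ be a structure. Suppose that for all families of sets $F_1,\ldots,F_{m+1}$ and all indexings $i_1,\ldots,i_{m+1}$ and $i'_1,\ldots,i'_{m+1}$ of this family such that for all $k$ either $i_k=i'_k$, or $F_k$ is some $E_l$ and $i_k$ and $i'_k$ are extracted from two admissible indexings of the structure $\langle E_1,\ldots,E_n,op_1,\ldots,op_p\rangle$ (that is, they are the $l$-th components of two such admissible indexings), the set of functions from $F_1\times\ldots\times F_m$ to $F_{m+1}$ that are computable relatively to $i_1,\ldots,i_{m+1}$ is the same as the set of those computable relatively to $i'_1,\ldots,i'_{m+1}$. Then computability is stable over the structure $\langle E_1,\ldots,E_n,op_1,\ldots,op_p\rangle$.
   Context: Computability over natural numbers is the usual one. A set $A \subseteq \mathbb{N}$ is effectively enumerable if it is empty or the image of a total computable function from $\mathbb{N}$ to $\mathbb{N}$. For $A \subseteq \mathbb{N}^m$ and $B \subseteq \mathbb{N}$, a computable function from $A$ to $B$ is a partial computable function that is defined at every element of $A$ and takes values in $B$ there. Indexing: an indexing of a set $E$ is a partial function $i$ from $\mathbb{N}$ to $E$ such that $dom(i)$ is effectively enumerable, $i$ is surjective, and there is a computable function $eq$ from $dom(i)\times dom(i)$ to $\{0,1\}$ with $eq(x,y)=1$ if $i(x)=i(y)$ and $eq(x,y)=0$ otherwise. An indexing of a family of sets $E_1,\ldots,E_n$ is a family $i_1,\ldots,i_n$ of indexings of $E_1,\ldots,E_n$. Computable function: given sets $E_1,\ldots,E_m,E_{m+1}$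 with indexings $i_1,\ldots,i_{m+1}$, a function $f: E_1\times\ldots\times E_m \to E_{m+1}$ is computable relatively to this indexing if there is a computable function $\hat f$ from $dom(i_1)\times\ldots\times dom(i_m)$ to $dom(i_{m+1})$ such that $i_{m+1}(\hat f(x_1,\ldots,x_m)) = f(i_1(x_1),\ldots,i_m(x_m))$ for all $x_k \in dom(i_k)$. Admissible indexing: a structure $\langle E_1,\ldots,E_n,op_1,\ldots,op_p\rangle$ consists of sets $E_1,\ldots,E_n$ and operations, each from a product of some of these sets to one of these sets. An indexing of it is an indexing of $E_1,\ldots,E_n$; it is admissible if every $op_k$ is computable relatively to the indexings of its domains and co-domain. Stable computability: computability is stable over $\langle E_1,\ldots,E_n,op_1,\ldots,op_p\rangle$ if there exists an admissible indexing of this structure and, for all admissible indexings $j_1,\ldots,j_n$ and $j'_1,\ldots,j'_n$ of it, there exist computable functions $h_k$ from $dom(j'_k)$ to $dom(j_k)$ such that $j'_k = j_k\circ h_k$, for $k=1,\ldots,n$.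
   Formalization: The formal theorem additionally assumes that the structure has an admissible indexing; without this the claim fails, e.g. for a single uncountable set with no operations, where only equal indexings are compared but stability requires an admissible indexing to exist. -}

module Defs where

open import Data.Fin.Base using (Fin; zero; suc)
open import Data.Nat.Base using (ℕ; zero; suc; _<_)
open import Data.Product.Base using (Σ-syntax; ∃-syntax; _×_; _,_)
open import Data.Sum.Base using (_⊎_)
open import Data.Unit.Polymorphic.Base using (⊤)
open import Data.Vec.Base using (Vec; []; _∷_; lookup)
open import Data.Vec.Relation.Binary.Pointwise.Inductive using (Pointwise)
open import Function.Base using (_∘_)
open import Function.Bundles using (_⇔_)
open import Level using (Level; _⊔_) renaming (suc to lsuc)
open import Relation.Binary.PropositionalEquality.Core using (_≡_; _≢_)
open import Relation.Unary using (Pred; U; Empty; _∈_)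

private
  variable
    ℓ a b : Level
    k m : ℕ

-- Partial computable functions are presented as μ-recursive functions.

data Code : ℕ → Set where
  zer  : Code 0
  succ : Code 1
  proj : Fin m → Code m
  comp : Code k → Vec (Code m) k → Code m
  prec : Code m → Code (suc (suc m)) → Code (suc m)
  min  : Code (suc m) → Code m

-- c [ xs ]⇓ y: the partial function computed by c is defined at xs, with
-- value y.

data _[_]⇓_ : Code m → Vec ℕ m → ℕ → Set where
  zer⇓   : zer [ [] ]⇓ 0
  succ⇓  : ∀ {x} → succ [ x ∷ [] ]⇓ suc x
  proj⇓  : ∀ {xs : Vec ℕ m} i → proj i [ xs ]⇓ lookup xs i
  comp⇓  : ∀ {f : Code k} {gs : Vec (Code m) k} {xs ys z} →
           Pointwise (λ g y → g [ xs ]⇓ y) gs ys → f [ ys ]⇓ z →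
           comp f gs [ xs ]⇓ z
  prec⇓₀ : ∀ {f : Code m} {g xs y} →
           f [ xs ]⇓ y → prec f g [ 0 ∷ xs ]⇓ y
  prec⇓₊ : ∀ {f : Code m} {g xs x r y} →
           prec f g [ x ∷ xs ]⇓ r → g [ x ∷ r ∷ xs ]⇓ y →
           prec f g [ suc x ∷ xs ]⇓ y
  min⇓   : ∀ {f : Code (suc m)} {xs y} →
           f [ y ∷ xs ]⇓ 0 → (∀ z → z < y → ∃[ v ] f [ z ∷ xs ]⇓ suc v) →
           min f [ xs ]⇓ y

-- The code may also be defined outside A, with arbitrary values there.

record ComputableFunction (A : Pred (Vec ℕ m) a) (B : Pred ℕ b) :
                          Set (a ⊔ b) where
  field
    code    : Code m
    defined : ∀ {xs} → xs ∈ A → ∃[ y ] code [ xs ]⇓ y × y ∈ B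

open ComputableFunction public

EffectivelyEnumerable : Pred ℕ a → Set a
EffectivelyEnumerable A =
  Empty A ⊎
  (Σ[ g ∈ ComputableFunction {m = 1} U U ]
     ∀ y → y ∈ A ⇔ (∃[ x ] code g [ x ∷ [] ]⇓ y))

-- A partial function from ℕ to E is given by its graph; deciding membership
-- in its domain need not be possible.

record PartialFunction (E : Set ℓ) : Set (lsuc ℓ) where
  field
    _↦_        : ℕ → E → Set ℓ
    functional : ∀ {x e e′} → x ↦ e → x ↦ e′ → e ≡ e′

  dom : Pred ℕ ℓ
  dom x = ∃[ e ] x ↦ e

_≐_ : {E : Set ℓ} → PartialFunction E → PartialFunction E → Set ℓ
i ≐ j = ∀ x e → (x i.↦ e) ⇔ (x j.↦ e)
  where
  module i = PartialFunction i
  module j = PartialFunction j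

record Indexing (E : Set ℓ) : Set (lsuc ℓ) where
  field
    partialFunction : PartialFunction E
  open PartialFunction partialFunction public
  field
    enumerable : EffectivelyEnumerable dom
    surjective : ∀ e → ∃[ x ] x ↦ e
    eq         : ComputableFunction {m = 2}
                   (λ xs → ∀ k → lookup xs k ∈ dom) (λ y → y ≡ 0 ⊎ y ≡ 1)
    eq-spec    : ∀ {x y e e′} → x ↦ e → y ↦ e′ →
                 (e ≡ e′ → code eq [ x ∷ y ∷ [] ]⇓ 1) ×
                 (e ≢ e′ → code eq [ x ∷ y ∷ [] ]⇓ 0)

open Indexing public using (partialFunction; dom)

infix 4 _⟨_⟩↦_

_⟨_⟩↦_ : {E : Set ℓ} → Indexing E → ℕ → E → Set ℓ
i ⟨ x ⟩↦ e = Indexing._↦_ i x e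

-- Iterated pairs rather than dependent functions on Fin m, so that tuples
-- with equal components are equal without function extensionality.

Product : (Fin m → Set ℓ) → Set ℓ
Product {m = zero}  F = ⊤
Product {m = suc m} F = F zero × Product (F ∘ suc)

component : {F : Fin m → Set ℓ} → Product F → ∀ k → F k
component (e , es) zero    = e
component (e , es) (suc k) = component es k

ComputableRelativelyTo :
  {F : Fin m → Set ℓ} {G : Set ℓ} →
  (∀ k → Indexing (F k)) → Indexing G → (Product F → G) → Set ℓ
ComputableRelativelyTo i j f =
  Σ[ f̂ ∈ ComputableFunction (λ xs → ∀ k → lookup xs k ∈ dom (i k)) (dom j) ]
    ∀ xs es → (∀ k → i k ⟨ lookup xs k ⟩↦ component es k) →
    ∃[ y ] code f̂ [ xs ]⇓ y × j ⟨ y ⟩↦ f es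

record Structure ℓ : Set (lsuc ℓ) where
  field
    n      : ℕ
    E      : Fin n → Set ℓ
    p      : ℕ
    arity  : Fin p → ℕ
    source : ∀ k → Fin (arity k) → Fin n
    target : Fin p → Fin n
    op     : ∀ k → Product (E ∘ source k) → E (target k)

record AdmissibleIndexing (S : Structure ℓ) : Set (lsuc ℓ) where
  open Structure S
  field
    indexing   : ∀ l → Indexing (E l)
    admissible : ∀ k → ComputableRelativelyTo
                         (indexing ∘ source k) (indexing (target k)) (op k)

open AdmissibleIndexing public

-- The index {F} of the second constructor expresses that F is some E l.

data Interchangeable (S : Structure ℓ) :
       {F : Set ℓ} → Indexing F → Indexing F → Set (lsuc ℓ) where
  same      : {F : Set ℓ} {i i′ : Indexing F} →
              partialFunction i ≐ partialFunction i′ → Interchangeable S i i′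
  extracted : (J J′ : AdmissibleIndexing S) (l : Fin (Structure.n S)) →
              Interchangeable S (indexing J l) (indexing J′ l)

-- The composite of j after h is taken on the domain of j′, the source of h.

FactorsThrough : {E : Set ℓ} → Indexing E → Indexing E → Set ℓ
FactorsThrough j′ j =
  Σ[ h ∈ ComputableFunction {m = 1} (λ xs → lookup xs zero ∈ dom j′) (dom j) ]
    ∀ x → x ∈ dom j′ → ∀ e →
    (j′ ⟨ x ⟩↦ e) ⇔ (∃[ y ] code h [ x ∷ [] ]⇓ y × j ⟨ y ⟩↦ e)

Stable : Structure ℓ → Set (lsuc ℓ)
Stable S =
  AdmissibleIndexing S ×
  (∀ (J J′ : AdmissibleIndexing S) l →
     FactorsThrough (indexing J′ l) (indexing J l))

{-# OPTIONS --safe #-}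
-- Computability of the identity of E l from j′ to j, which the hypothesis
-- gives from its computability from j′ to j′, is exactly a factorization of
-- j′ through j.
module Submission where

open import Data.Fin.Base using (Fin; zero)
open import Data.Nat.Base using (ℕ)
open import Data.Nat.Properties using (<-cmp)
open import Data.Product.Base using (∃-syntax; _×_; _,_; proj₁; proj₂)
open import Data.Vec.Base using (Vec; []; _∷_)
open import Data.Vec.Relation.Binary.Pointwise.Inductive using (Pointwise; []; _∷_)
open import Function.Base using (const)
open import Function.Bundles using (_⇔_; mk⇔; Equivalence)
open import Function.Construct.Identity using (⇔-id)
open import Level using (Level)
open import Relation.Binary.Definitions using (tri<; tri≈; tri>)
open import Relation.Binary.PropositionalEquality.Core using (_≡_; refl; cong₂)
open import Defs

private
  variable
    ℓ : Level
    k m : ℕ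

mutual
  ⇓-functional : ∀ {c : Code m} {xs y z} → c [ xs ]⇓ y → c [ xs ]⇓ z → y ≡ z
  ⇓-functional zer⇓        zer⇓      = refl
  ⇓-functional succ⇓       succ⇓     = refl
  ⇓-functional (proj⇓ i)   (proj⇓ _) = refl
  ⇓-functional (comp⇓ gs f) (comp⇓ gs′ f′)
    with refl ← ⇓*-functional gs gs′ = ⇓-functional f f′
  ⇓-functional (prec⇓₀ f)  (prec⇓₀ f′) = ⇓-functional f f′
  ⇓-functional (prec⇓₊ r g) (prec⇓₊ r′ g′)
    with refl ← ⇓-functional r r′ = ⇓-functional g g′
  ⇓-functional {y = y} {z} (min⇓ f0 f+) (min⇓ f0′ f+′) with <-cmp y z
  ... | tri≈ _ y≡z _ = y≡z
  ... | tri< y<z _ _ with () ← ⇓-functional f0 (proj₂ (f+′ y y<z))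
  ... | tri> _ _ z<y with () ← ⇓-functional (proj₂ (f+ z z<y)) f0′

  ⇓*-functional : ∀ {gs : Vec (Code m) k} {xs ys zs} →
                  Pointwise (λ g y → g [ xs ]⇓ y) gs ys →
                  Pointwise (λ g z → g [ xs ]⇓ z) gs zs → ys ≡ zs
  ⇓*-functional []       []         = refl
  ⇓*-functional (g ∷ gs) (g′ ∷ gs′) =
    cong₂ _∷_ (⇓-functional g g′) (⇓*-functional gs gs′)

identity-computable : {E : Set ℓ} (i : Indexing E) →
                      ComputableRelativelyTo {m = 1} {F = const E} (const i) i proj₁
identity-computable i =
  record { code    = proj zero
         ; defined = λ xs∈dom → _ , proj⇓ zero , xs∈dom zero } ,
  λ _ _ xs↦es → _ , proj⇓ zero , xs↦es zero

identity-computable⇒factorsThrough :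
  {E : Set ℓ} (j′ j : Indexing E) →
  ComputableRelativelyTo {m = 1} {F = const E} (const j′) j proj₁ →
  FactorsThrough j′ j
identity-computable⇒factorsThrough j′ j (f̂ , f̂-spec) = h , factors
  where
  h : ComputableFunction _ (dom j)
  h = record { code    = code f̂
             ; defined = λ { {_ ∷ []} x∈dom → defined f̂ λ { zero → x∈dom } } }

  image : ∀ {x e} → j′ ⟨ x ⟩↦ e → ∃[ y ] code f̂ [ x ∷ [] ]⇓ y × j ⟨ y ⟩↦ e
  image {x} {e} x↦e = f̂-spec (x ∷ []) (e , _) λ { zero → x↦e }

  factors : ∀ x → dom j′ x → ∀ e →
            (j′ ⟨ x ⟩↦ e) ⇔ (∃[ y ] code f̂ [ x ∷ [] ]⇓ y × j ⟨ y ⟩↦ e)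
  factors x (e′ , x↦e′) e = mk⇔ image preimage
    where
    preimage : ∃[ y ] code f̂ [ x ∷ [] ]⇓ y × j ⟨ y ⟩↦ e → j′ ⟨ x ⟩↦ e
    preimage (y , x⇓y , y↦e)
      with y′ , x⇓y′ , y′↦e′ ← image x↦e′
      with refl ← ⇓-functional x⇓y x⇓y′
      with refl ← Indexing.functional j y↦e y′↦e′ = x↦e′

proposition3 : ∀ {ℓ} (S : Structure ℓ) →
    AdmissibleIndexing S →
    (∀ (m : ℕ) (F : Fin m → Set ℓ) (G : Set ℓ)
    (i i′ : ∀ k → Indexing (F k)) (j j′ : Indexing G) →
    (∀ k → Interchangeable S (i k) (i′ k)) →
    Interchangeable S j j′ →
    ∀ (f : Product F → G) →
    ComputableRelativelyTo i j f ⇔ ComputableRelativelyTo i′ j′ f) →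
    Stable S
proposition3 S J₀ invariant = J₀ , λ J J′ l →
  let j  = indexing J l
      j′ = indexing J′ l
  in identity-computable⇒factorsThrough j′ j
       (Equivalence.to
          (invariant 1 _ _ (const j′) (const j′) j′ j
             (λ _ → same λ _ _ → ⇔-id _) (extracted J′ J l) proj₁)
          (identity-computable j′))
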